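{- Let $R$ be a commutative ring with unity, let $m\ge1$ be an integer, and let $\lambda_1:\mathbb N\times\mathbb Z\to R$ be a lambda-recursive family of order $m$ with principal factor $(p_n)$ and auxiliary factor $h_{(n,k)}=h_n$ independent of $k$. Let $\mathcal M_{(n,k)}$ denote the algebraic expansion matrix with base sequence $\lambda_1$. Then, for all $n\in\mathbb N$ and $1\le k\le w_m(n)$, $$|\mathcal M_{(n,k)}|=\Bigl(\prod_{j=1}^{k}p_{n-(j-1)m}\Bigr)|\mathcal M_{(n-1,k)}|-\Bigl(\prod_{j=1}^{k-1}p_{n-(j-1)m}\Bigr)h_{n-(k-1)m}\,\lambda_1(n-km,0)\,|\mathcal M_{(n-1,k-1)}|,$$ where $|\cdot|$ denotes the determinant.
   Context: $\mathbb N=\{0,1,2,\dots\}$ and $w_m(n)=\lfloor n/m\rfloor$. A family $\lambda:\mathbb N\times\mathbb Z\to R$ has triangular support of order $m$ (written $\lambda\in\Delta_m$) if $\lambda(n,k)=0$ whenever $k<0$ or $k>w_m(n)$. A family $\lambda_1\in\Delta_m$ is lambda-recursive of order $m$ if there exist $p_n\in R$ (principal factor), $h_{(n,k)}\in R$ (auxiliary factor) and initial data $c_n\in R$ for $0\le n\le m-1$ such that, for all $n\in\mathbb N$ and $0\le k\le w_m(n)$: $\lambda_1(n,0)=c_n$ if $0\le n\le m-1$ (and $k=0$), and $\lambda_1(n,k)=p_n\,\lambda_1(n-1,k)-h_{(n,k)}\,\lambda_1(n-m,k-1)$ if $n\ge m$. The algebraic expansion matrix with base sequence $\lambda_1$ is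 the $k\times k$ matrix $\mathcal M_{(n,k)}=(a_{ij})_{1\le i,j\le k}$ with $a_{ij}=\lambda_1\bigl(n-(j-1)m,\,i-j+1\bigr)$ if $j\le i+1$ and $a_{ij}=0$ if $j>i+1$. This formula is used for all $n\in\mathbb N$, $k\ge1$ with $n-(k-1)m\ge0$ (so that all first arguments are in $\mathbb N$), and the determinant of the empty matrix is $|\mathcal M_{(n,0)}|=1$. -}

module Defs where

open import Algebra.Bundles using (CommutativeRing)
import Algebra.Definitions.RawMonoid as RawMonoidOps
import Algebra.Properties.Semiring.Exp as SemiringExp
open import Data.Bool.Base using (if_then_else_)
open import Data.Fin.Base using (Fin; zero; suc; toℕ; punchIn)
open import Data.Integer.Base as ℤ using (ℤ; +_; 0ℤ; 1ℤ)
open import Data.Nat.Base as ℕ using (ℕ; zero; suc; NonZero; _∸_; _≤ᵇ_)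
open import Data.Nat.DivMod using (_/_)
open import Data.Sum.Base using (_⊎_)
open import Level using (_⊔_)

w : (m : ℕ) .{{_ : NonZero m}} → ℕ → ℕ
w m n = n / m

module Lambda {c ℓ} (R : CommutativeRing c ℓ) where

  open CommutativeRing R hiding (zero)
  open SemiringExp semiring using (_^_)
  open RawMonoidOps +-rawMonoid using (sum)
  open RawMonoidOps *-rawMonoid using () renaming (sum to product)

  -- ∏ k f is the product of f 1, …, f k; the index starts at 1.
  ∏ : ℕ → (ℕ → Carrier) → Carrier
  ∏ k f = product {k} (λ j → f (suc (toℕ j)))

  Matrix : ℕ → Set c
  Matrix k = Fin k → Fin k → Carrier

  -- Laplace expansion along the first row. With 0-based indices the sign of
  -- the j-th cofactor is (-1)^j.
  det : ∀ {k} → Matrix k → Carrier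
  det {zero}  A = 1#
  det {suc k} A = sum {suc k} (λ j →
    ((- 1#) ^ toℕ j) * (A zero j * det (λ r s → A (suc r) (punchIn j s))))

  Family : Set c
  Family = ℕ → ℤ → Carrier

  TriangularSupport : (m : ℕ) .{{_ : NonZero m}} → Family → Set ℓ
  TriangularSupport m lam =
    ∀ n k → (k ℤ.< 0ℤ) ⊎ (+ (w m n) ℤ.< k) → lam n k ≈ 0#

  -- The factors p and h are total on ℕ for convenience: only the values p n
  -- and h n k with m ≤ n and k ≤ w m n are constrained.
  record IsLambdaRecursive (m : ℕ) .{{_ : NonZero m}}
                           (p : ℕ → Carrier) (h : ℕ → ℕ → Carrier)
                           (λ₁ : Family) : Set (c ⊔ ℓ) where
    field
      support      : TriangularSupport m λ₁
      initialData  : Fin m → Carrier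
      initial      : ∀ (i : Fin m) → λ₁ (toℕ i) 0ℤ ≈ initialData i
      recursion    : ∀ n k → m ℕ.≤ n → k ℕ.≤ w m n →
                     λ₁ n (+ k) ≈ p n * λ₁ (n ∸ 1) (+ k)
                                  - h n k * λ₁ (n ∸ m) (+ k ℤ.- 1ℤ)

  -- Row and column indices i, j start at 1 here. The truncated subtractions
  -- are exact for j ≤ k whenever (k - 1) m ≤ n, the only range in which the
  -- k × k matrix is meaningful.
  entry : ℕ → Family → ℕ → ℕ → ℕ → Carrier
  entry m λ₁ n i j =
    if j ≤ᵇ suc i
    then λ₁ (n ∸ (j ∸ 1) ℕ.* m) (+ i ℤ.- + j ℤ.+ 1ℤ)
    else 0#

  expansionMatrix : ℕ → Family → ℕ → (k : ℕ) → Matrix k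
  expansionMatrix m λ₁ n k i j = entry m λ₁ n (suc (toℕ i)) (suc (toℕ j))

{-# OPTIONS --safe #-}

-- Column s of M(n,k) holds the values of λ₁ (n - s m). The recursion writes it
-- as p (n - s m) times column s of M(n-1,k) minus h (n - s m) times column
-- s + 1 of M(n,k). Working through the columns from left to right, the second
-- term repeats a column still present in the determinant and drops out, except
-- for the last column, where it is h (n - (k-1) m) λ₁ (n - k m, 0) times the
-- last unit vector, with cofactor M(n-1,k-1).
module Submission where

open import Defs
open import Algebra.Bundles using (CommutativeRing)
import Algebra.Definitions.RawMonoid as RawMonoidOps
import Algebra.Properties.Monoid.Sum as MonoidSum
import Algebra.Properties.Ring as RingProperties
import Algebra.Properties.Semiring.Exp as SemiringExp
import Algebra.Solver.Ring.NaturalCoefficients.Default as SemiringSolver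
open import Data.Bool.Base using (true; false; if_then_else_)
open import Data.Fin.Base using (Fin; zero; suc; toℕ; punchIn)
open import Data.Integer.Base as ℤ using (0ℤ; 1ℤ; +_; _⊖_)
import Data.Integer.Properties as ℤ
open import Data.Nat.Base as ℕ using (ℕ; zero; suc; NonZero; _∸_; _≤_; _<_; _<ᵇ_; z≤n; s≤s)
open import Data.Nat.DivMod using (m/n*n≤m; /-monoˡ-≤; m/n≡1+[m∸n]/n)
import Data.Nat.Properties as ℕ
open import Data.Product.Base using (_×_; _,_; proj₁; proj₂)
open import Data.Sum.Base using (inj₁; inj₂)
open import Function.Base using (_∘_)
open import Relation.Binary.PropositionalEquality as ≡ using (_≡_)
import Relation.Binary.Reasoning.Setoid as SetoidReasoning
open import Relation.Nullary using (yes; no)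

module _ {c ℓ} (R : CommutativeRing c ℓ) where

  open CommutativeRing R hiding (zero)
  open Lambda R
  open SemiringExp semiring using (_^_)
  open RawMonoidOps +-rawMonoid using (sum)
  open RawMonoidOps *-rawMonoid using () renaming (sum to product)
  open MonoidSum +-monoid using (sum-cong-≋; sum-replicate-zero)
  open RingProperties ring using (-1*x≈-x; -0#≈0#; -‿distribˡ-*; -‿distribʳ-*)
  open SetoidReasoning setoid
  open SemiringSolver commutativeSemiring using (solve; _:=_; _:+_; _:*_)

  -- Determinants of lower Hessenberg matrices.

  -- u s t is the entry of column s that lies t rows below the diagonal.
  staircase : (ℕ → ℕ → Carrier) → ℕ → ℕ → Carrier
  staircase u r       zero    = u 0 r
  staircase u zero    (suc s) = 0#
  staircase u (suc r) (suc s) = staircase (u ∘ suc) r s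

  -- The first column is a separate parameter because deleting row 0 and one of the first two
  -- columns leaves the same shape, with `u` shifted and a new first column. Column `suc s` starts
  -- on the superdiagonal with `u s 0`.
  hessenberg : (ℕ → Carrier) → (ℕ → ℕ → Carrier) → ℕ → ℕ → Carrier
  hessenberg v u r zero    = v r
  hessenberg v u r (suc s) = staircase u r s

  -- The determinant of order suc j of hessenberg v u.
  hessenbergDet : ℕ → (ℕ → Carrier) → (ℕ → ℕ → Carrier) → Carrier
  hessenbergDet zero    v u = v 0
  hessenbergDet (suc j) v u =
    v 0 * hessenbergDet j (u 0 ∘ suc) (u ∘ suc) + - u 0 0 * hessenbergDet j (v ∘ suc) (u ∘ suc)

  hessenberg-suc-suc : ∀ v u r s →
    hessenberg v u (suc r) (suc s) ≡ hessenberg (u 0 ∘ suc) (u ∘ suc) r s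
  hessenberg-suc-suc v u r zero    = ≡.refl
  hessenberg-suc-suc v u r (suc s) = ≡.refl

  hessenberg-punchIn₁ : ∀ {j} v u r (s : Fin (suc j)) →
    hessenberg v u (suc r) (toℕ (punchIn (suc zero) s)) ≡ hessenberg (v ∘ suc) (u ∘ suc) r (toℕ s)
  hessenberg-punchIn₁         v u r zero    = ≡.refl
  hessenberg-punchIn₁ {suc j} v u r (suc s) = ≡.refl

  -- Row 0 vanishes beyond columns 0 and 1, so the Laplace expansion has two terms, and both minors
  -- are Hessenberg again. Pointwise agreement of `A` suffices, which lets the induction pass to
  -- minors without function extensionality.
  det-hessenberg : ∀ j (A : Matrix (suc j)) v u →
    (∀ r s → A r s ≈ hessenberg v u (toℕ r) (toℕ s)) →
    det A ≈ hessenbergDet j v u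
  det-hessenberg zero A v u A≈ = begin
    1# * (A zero zero * 1#) + 0# ≈⟨ +-identityʳ _ ⟩
    1# * (A zero zero * 1#)      ≈⟨ *-identityˡ _ ⟩
    A zero zero * 1#             ≈⟨ *-identityʳ _ ⟩
    A zero zero                  ≈⟨ A≈ zero zero ⟩
    v 0                          ∎
  det-hessenberg (suc j) A v u A≈ = begin
    1# * (A zero zero * det A₀) + ((- 1# * 1#) * (A zero (suc zero) * det A₁) + sum tail)
      ≈⟨ +-cong (*-identityˡ _) (+-cong (*-congʳ (*-identityʳ _)) sum-tail) ⟩
    A zero zero * det A₀ + (- 1# * (A zero (suc zero) * det A₁) + 0#)
      ≈⟨ +-congˡ (trans (+-identityʳ _) (-1*x≈-x _)) ⟩
    A zero zero * det A₀ - A zero (suc zero) * det A₁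
      ≈⟨ +-cong (*-cong (A≈ zero zero) minor₀)
           (trans (-‿distribˡ-* _ _) (*-cong (-‿cong (A≈ zero (suc zero))) minor₁)) ⟩
    hessenbergDet (suc j) v u ∎
    where
    A₀ A₁ : Matrix (suc j)
    A₀ r s = A (suc r) (suc s)
    A₁ r s = A (suc r) (punchIn (suc zero) s)

    tail : Fin j → Carrier
    tail i = (- 1#) ^ toℕ (suc (suc i)) *
      (A zero (suc (suc i)) * det (λ r s → A (suc r) (punchIn (suc (suc i)) s)))

    sum-tail : sum tail ≈ 0#
    sum-tail = trans
      (sum-cong-≋ (λ i → trans (*-congˡ (trans (*-congʳ (A≈ zero (suc (suc i)))) (zeroˡ _))) (zeroʳ _)))
      (sum-replicate-zero j)

    minor₀ : det A₀ ≈ hessenbergDet j (u 0 ∘ suc) (u ∘ suc)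
    minor₀ = det-hessenberg j A₀ _ _ λ r s →
      trans (A≈ (suc r) (suc s)) (reflexive (hessenberg-suc-suc v u (toℕ r) (toℕ s)))

    minor₁ : det A₁ ≈ hessenbergDet j (v ∘ suc) (u ∘ suc)
    minor₁ = det-hessenberg j A₁ _ _ λ r s →
      trans (A≈ (suc r) (punchIn (suc zero) s)) (reflexive (hessenberg-punchIn₁ v u (toℕ r) s))

  -- Dependence on the first column.

  hessenbergDet-cong : ∀ j {v v′} u → (∀ r → v r ≈ v′ r) →
    hessenbergDet j v u ≈ hessenbergDet j v′ u
  hessenbergDet-cong zero    u v≈ = v≈ 0
  hessenbergDet-cong (suc j) u v≈ =
    +-cong (*-congʳ (v≈ 0)) (*-congˡ (hessenbergDet-cong j (u ∘ suc) (v≈ ∘ suc)))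

  hessenbergDet-linear : ∀ j a b x y u →
    hessenbergDet j (λ r → a * x r + b * y r) u ≈ a * hessenbergDet j x u + b * hessenbergDet j y u
  hessenbergDet-linear zero    a b x y u = refl
  hessenbergDet-linear (suc j) a b x y u =
    trans (+-congˡ (*-congˡ (hessenbergDet-linear j a b (x ∘ suc) (y ∘ suc) (u ∘ suc))))
      (solve 8 (λ a b x y d u e f →
          (a :* x :+ b :* y) :* d :+ u :* (a :* e :+ b :* f) :=
          a :* (x :* d :+ u :* e) :+ b :* (y :* d :+ u :* f))
        refl a b (x 0) (y 0) _ (- u 0 0) _ _)

  hessenbergDet-zero : ∀ j u → hessenbergDet j (λ _ → 0#) u ≈ 0#
  hessenbergDet-zero zero    u = refl
  hessenbergDet-zero (suc j) u =
    trans (+-cong (zeroˡ _) (trans (*-congˡ (hessenbergDet-zero j (u ∘ suc))) (zeroʳ _)))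
      (+-identityˡ 0#)

  -- The first two columns coincide, so deleting either one leaves the same minor, and the two terms
  -- of the expansion cancel.
  hessenbergDet-repeated : ∀ j u → hessenbergDet (suc j) (u 0) u ≈ 0#
  hessenbergDet-repeated j u = trans (+-congˡ (sym (-‿distribˡ-* _ _))) (-‿inverseʳ _)

  unit₀ : ℕ → Carrier
  unit₀ zero    = 1#
  unit₀ (suc _) = 0#

  -- A unit vector as first column borders a determinant without changing it. With this border the
  -- empty matrix becomes the one-by-one case, so order 0 needs no separate treatment later.
  hessenbergDet-unit₀ : ∀ j u →
    hessenbergDet (suc j) unit₀ u ≈ hessenbergDet j (u 0 ∘ suc) (u ∘ suc)
  hessenbergDet-unit₀ j u = begin
    1# * d + - u 0 0 * hessenbergDet j (λ _ → 0#) (u ∘ suc)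
      ≈⟨ +-cong (*-identityˡ d) (trans (*-congˡ (hessenbergDet-zero j (u ∘ suc))) (zeroʳ _)) ⟩
    d + 0# ≈⟨ +-identityʳ d ⟩
    d      ∎
    where d = hessenbergDet j (u 0 ∘ suc) (u ∘ suc)

  -- Replacing the columns one by one.

  ∏< : ℕ → (ℕ → Carrier) → Carrier
  ∏< k q = product {k} (q ∘ toℕ)

  -- Column `u (suc s)` starts one row lower than `u s`, so its entry `t` shares a row with entry
  -- `suc t` of `u s`, and the top entry has no `g`-term.
  ColumnRecursion : (q g : ℕ → Carrier) (u u′ : ℕ → ℕ → Carrier) → ℕ → Set ℓ
  ColumnRecursion q g u u′ s =
    u s 0 ≈ q s * u′ s 0 ×
    (∀ t → u s (suc t) ≈ q s * u′ s (suc t) + g s * u (suc s) t)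

  x≈yz⇒-x≈y-z : ∀ {x y z} → x ≈ y * z → - x ≈ y * - z
  x≈yz⇒-x≈y-z x≈yz = trans (-‿cong x≈yz) (-‿distribʳ-* _ _)

  -- Induction on the number of columns, expanding along row 0. The first column `v` is arbitrary
  -- because the induction hypothesis is applied to two different ones, `u′ 0 ∘ suc` and `v ∘ suc`.
  hessenbergDet-recursion : ∀ j q g v u u′ →
    (∀ s → s ≤ j → ColumnRecursion q g u u′ s) →
    hessenbergDet (suc j) v u ≈
      ∏< (suc j) q * hessenbergDet (suc j) v u′
      + ∏< j q * g j * u (suc j) 0 * hessenbergDet j v u′
  hessenbergDet-recursion zero q g v u u′ rec = begin
    v 0 * u 0 1 + - u 0 0 * v 1
      -- Column `u 1` lies outside this matrix of order two, so its contribution `g 0 * u 1 0`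
      -- cannot cancel and becomes the correction term.
      ≈⟨ +-cong (*-congˡ (proj₂ (rec 0 z≤n) 0)) (*-congʳ (x≈yz⇒-x≈y-z (proj₁ (rec 0 z≤n)))) ⟩
    v 0 * (q 0 * u′ 0 1 + g 0 * u 1 0) + q 0 * - u′ 0 0 * v 1
      ≈⟨ solve 7 (λ v₀ v₁ q g a b e →
          v₀ :* (q :* a :+ g :* e) :+ q :* b :* v₁ :=
          q :* (v₀ :* a :+ b :* v₁) :+ g :* e :* v₀)
         refl (v 0) (v 1) (q 0) (g 0) (u′ 0 1) (- u′ 0 0) (u 1 0) ⟩
    q 0 * (v 0 * u′ 0 1 + - u′ 0 0 * v 1) + g 0 * u 1 0 * v 0
      ≈⟨ +-cong (*-congʳ (*-identityʳ _)) (*-congʳ (*-congʳ (*-identityˡ _))) ⟨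
    ∏< 1 q * hessenbergDet 1 v u′ + 1# * g 0 * u 1 0 * v 0 ∎
  hessenbergDet-recursion (suc j) q g v u u′ rec = begin
    v 0 * D (u 0 ∘ suc) + - u 0 0 * D (v ∘ suc)
      -- Both products gain the factor `q 0`: the first by replacing the leading column of its
      -- minor, the second through the top entry `u 0 0`.
      ≈⟨ +-cong (*-congˡ (trans first-column (*-congˡ (ih (u′ 0 ∘ suc)))))
           (*-cong (x≈yz⇒-x≈y-z (proj₁ (rec 0 z≤n))) (ih (v ∘ suc))) ⟩
    v 0 * (q 0 * (P * D′ (u′ 0 ∘ suc) + Q * gₗ * e * d′ (u′ 0 ∘ suc)))
      + q 0 * - u′ 0 0 * (P * D′ (v ∘ suc) + Q * gₗ * e * d′ (v ∘ suc))
      ≈⟨ solve 11 (λ v₀ q₀ u₀ P Q g e x y x′ y′ →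
          v₀ :* (q₀ :* (P :* x :+ Q :* g :* e :* y))
            :+ q₀ :* u₀ :* (P :* x′ :+ Q :* g :* e :* y′) :=
          q₀ :* P :* (v₀ :* x :+ u₀ :* x′)
            :+ q₀ :* Q :* g :* e :* (v₀ :* y :+ u₀ :* y′))
         refl (v 0) (q 0) (- u′ 0 0) P Q gₗ e _ _ _ _ ⟩
    q 0 * P * hessenbergDet (suc (suc j)) v u′
      + q 0 * Q * gₗ * e * hessenbergDet (suc j) v u′ ∎
    where
    D D′ d′ : (ℕ → Carrier) → Carrier
    D  x = hessenbergDet (suc j) x (u ∘ suc)
    D′ x = hessenbergDet (suc j) x (u′ ∘ suc)
    d′ x = hessenbergDet j x (u′ ∘ suc)

    P Q gₗ e : Carrier
    P  = ∏< (suc j) (q ∘ suc)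
    Q  = ∏< j (q ∘ suc)
    gₗ = g (suc j)
    e  = u (suc (suc j)) 0

    ih : ∀ x → D x ≈ P * D′ x + Q * gₗ * e * d′ x
    ih x = hessenbergDet-recursion j (q ∘ suc) (g ∘ suc) x (u ∘ suc) (u′ ∘ suc)
      (λ s s≤j → rec (suc s) (s≤s s≤j))

    first-column : D (u 0 ∘ suc) ≈ q 0 * D (u′ 0 ∘ suc)
    first-column = begin
      D (u 0 ∘ suc)
        ≈⟨ hessenbergDet-cong (suc j) (u ∘ suc) (proj₂ (rec 0 z≤n)) ⟩
      D (λ t → q 0 * u′ 0 (suc t) + g 0 * u 1 t)
        ≈⟨ hessenbergDet-linear (suc j) (q 0) (g 0) (u′ 0 ∘ suc) (u 1) (u ∘ suc) ⟩
      q 0 * D (u′ 0 ∘ suc) + g 0 * D (u 1)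
        -- Here `u 1` is also the second column of the determinant.
        ≈⟨ +-congˡ (trans (*-congˡ (hessenbergDet-repeated j (u ∘ suc))) (zeroʳ _)) ⟩
      q 0 * D (u′ 0 ∘ suc) + 0#
        ≈⟨ +-identityʳ _ ⟩
      q 0 * D (u′ 0 ∘ suc) ∎

  -- The expansion matrix as a Hessenberg matrix.

  staircase-closed : ∀ u r s →
    staircase u r s ≡ (if s <ᵇ suc r then u s (r ∸ s) else 0#)
  staircase-closed u r       zero    = ≡.refl
  staircase-closed u zero    (suc s) = ≡.refl
  staircase-closed u (suc r) (suc s) = staircase-closed (u ∘ suc) r s

  module _ (m : ℕ) (λ₁ : Family) where

    columns : ℕ → ℕ → ℕ → Carrier
    columns n s t = λ₁ (n ∸ s ℕ.* m) (+ t)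

    entry-staircase : ∀ n r s → entry m λ₁ n (suc r) (suc s) ≡ staircase (columns n) (suc r) s
    entry-staircase n r s
      rewrite staircase-closed (columns n) (suc r) s
      -- The test in `entry` computes to this same boolean, so one case split settles both sides.
      -- The second term keeps the bound `s ≤ suc r`, which makes the integer index a natural
      -- number.
      with s <ᵇ suc (suc r) | ℕ.<ᵇ⇒< s (suc (suc r))
    ... | false | _ = ≡.refl
    ... | true  | s< = ≡.cong (λ₁ (n ∸ s ℕ.* m)) index
      where
      index : + suc r ℤ.- + suc s ℤ.+ 1ℤ ≡ + (suc r ∸ s)
      index = ≡.trans (≡.cong (ℤ._+ 1ℤ) (ℤ.[1+m]⊖[1+n]≡m⊖n r s))
        (≡.trans (ℤ.distribˡ-⊖-+-pos 1 r s)
        (≡.trans (≡.cong (_⊖ s) (ℕ.+-comm r 1)) (ℤ.⊖-≥ (ℕ.≤-pred (s< _)))))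

    -- The columns of the expansion matrix start one row above the diagonal, so it is the minor of
    -- `hessenberg unit₀ (columns n)` without row 0 and column 0.
    det-expansionMatrix : ∀ n k →
      det (expansionMatrix m λ₁ n k) ≈ hessenbergDet k unit₀ (columns n)
    det-expansionMatrix n zero    = refl
    det-expansionMatrix n (suc j) = trans
      (det-hessenberg j _ _ _ λ r s → reflexive (≡.trans (entry-staircase n (toℕ r) (toℕ s))
        (hessenberg-suc-suc unit₀ (columns n) (toℕ r) (toℕ s))))
      (sym (hessenbergDet-unit₀ j (columns n)))

  -- Column recursion from the lambda-recursion.

  module _ (m : ℕ) .{{_ : NonZero m}} (p h : ℕ → Carrier) (λ₁ : Family)
           (isRec : IsLambdaRecursive m p (λ n _ → h n) λ₁) where

    open IsLambdaRecursive isRec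

    -- The subtracted term has second index -1 and vanishes by triangular support.
    recursion-zero : ∀ n → m ≤ n → λ₁ n 0ℤ ≈ p n * λ₁ (n ∸ 1) 0ℤ
    recursion-zero n m≤n = begin
      λ₁ n 0ℤ ≈⟨ recursion n 0 m≤n z≤n ⟩
      p n * λ₁ (n ∸ 1) 0ℤ - h n * λ₁ (n ∸ m) (0ℤ ℤ.- 1ℤ)
        ≈⟨ +-congˡ (-‿cong (trans (*-congˡ (support (n ∸ m) _ (inj₁ ℤ.-<+))) (zeroʳ _))) ⟩
      p n * λ₁ (n ∸ 1) 0ℤ - 0#
        ≈⟨ +-congˡ -0#≈0# ⟩
      p n * λ₁ (n ∸ 1) 0ℤ + 0#
        ≈⟨ +-identityʳ _ ⟩
      p n * λ₁ (n ∸ 1) 0ℤ ∎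

    -- Outside the triangular support all three values vanish.
    recursion-suc : ∀ n t → m ≤ n →
      λ₁ n (+ suc t) ≈ p n * λ₁ (n ∸ 1) (+ suc t) + - h n * λ₁ (n ∸ m) (+ t)
    recursion-suc n t m≤n with suc t ℕ.≤? w m n
    ... | yes t<w = trans (recursion n (suc t) m≤n t<w) (+-congˡ (-‿distribˡ-* _ _))
    ... | no  t≮w = begin
      λ₁ n (+ suc t) ≈⟨ vanish n (suc t) w<1+t ⟩
      0#             ≈⟨ +-identityˡ 0# ⟨
      0# + 0#
        ≈⟨ +-cong (trans (*-congˡ (vanish (n ∸ 1) (suc t) w[n-1]<1+t)) (zeroʳ _))
             (trans (*-congˡ (vanish (n ∸ m) t w[n-m]<t)) (zeroʳ _)) ⟨
      p n * λ₁ (n ∸ 1) (+ suc t) + - h n * λ₁ (n ∸ m) (+ t) ∎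
      where
      vanish : ∀ n k → w m n < k → λ₁ n (+ k) ≈ 0#
      vanish n k w<k = support n (+ k) (inj₂ (ℤ.+<+ w<k))

      w<1+t : w m n < suc t
      w<1+t = ℕ.≰⇒> t≮w

      w[n-1]<1+t : w m (n ∸ 1) < suc t
      w[n-1]<1+t = ℕ.≤-<-trans (/-monoˡ-≤ m (ℕ.m∸n≤m n 1)) w<1+t

      w[n-m]<t : w m (n ∸ m) < t
      -- Lowering `n` by `m` lowers `w m n` by exactly one, matching the drop from `suc t` to `t`.
      w[n-m]<t = ℕ.≤-pred (≡.subst (_< suc t) (m/n≡1+[m∸n]/n m≤n) w<1+t)

    -- The minus sign is absorbed into the factor `g`. Lowering the first argument by 1 leads to the
    -- same column for `n ∸ 1`, and lowering it by `m` leads to the next column for `n`.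
    column-recursion : ∀ n s → m ≤ n ∸ s ℕ.* m →
      ColumnRecursion (λ s → p (n ∸ s ℕ.* m)) (λ s → - h (n ∸ s ℕ.* m))
        (columns m λ₁ n) (columns m λ₁ (n ∸ 1)) s
    column-recursion n s m≤ =
      ≡.subst (λ i → λ₁ (n ∸ s ℕ.* m) 0ℤ ≈ p (n ∸ s ℕ.* m) * λ₁ i 0ℤ) n-sm-1
        (recursion-zero (n ∸ s ℕ.* m) m≤) ,
      λ t → ≡.subst₂
        (λ i i′ → λ₁ (n ∸ s ℕ.* m) (+ suc t) ≈
          p (n ∸ s ℕ.* m) * λ₁ i (+ suc t) + - h (n ∸ s ℕ.* m) * λ₁ i′ (+ t))
        n-sm-1 n-sm-m (recursion-suc (n ∸ s ℕ.* m) t m≤)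
      where
      n-sm-1 : n ∸ s ℕ.* m ∸ 1 ≡ n ∸ 1 ∸ s ℕ.* m
      n-sm-1 = ≡.trans (ℕ.∸-+-assoc n (s ℕ.* m) 1)
        (≡.trans (≡.cong (n ∸_) (ℕ.+-comm (s ℕ.* m) 1)) (≡.sym (ℕ.∸-+-assoc n 1 (s ℕ.* m))))

      n-sm-m : n ∸ s ℕ.* m ∸ m ≡ n ∸ suc s ℕ.* m
      n-sm-m = ≡.trans (ℕ.∸-+-assoc n (s ℕ.* m) m) (≡.cong (n ∸_) (ℕ.+-comm (s ℕ.* m) m))

    det-expansionMatrix-recursion : ∀ n j → suc j ≤ w m n →
      det (expansionMatrix m λ₁ n (suc j)) ≈
        ∏< (suc j) (λ s → p (n ∸ s ℕ.* m)) * det (expansionMatrix m λ₁ (n ∸ 1) (suc j))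
        - ∏< j (λ s → p (n ∸ s ℕ.* m)) * h (n ∸ j ℕ.* m) * λ₁ (n ∸ suc j ℕ.* m) 0ℤ
          * det (expansionMatrix m λ₁ (n ∸ 1) j)
    det-expansionMatrix-recursion n j j<w = begin
      det (expansionMatrix m λ₁ n (suc j))
        ≈⟨ det-expansionMatrix m λ₁ n (suc j) ⟩
      hessenbergDet (suc j) unit₀ (columns m λ₁ n)
        ≈⟨ hessenbergDet-recursion j _ _ unit₀ (columns m λ₁ n) (columns m λ₁ (n ∸ 1))
             (λ s s≤j → column-recursion n s (m≤n-sm s≤j)) ⟩
      P * hessenbergDet (suc j) unit₀ (columns m λ₁ (n ∸ 1))
        + Q * - hₗ * e * hessenbergDet j unit₀ (columns m λ₁ (n ∸ 1))
        ≈⟨ +-cong (*-congˡ (det-expansionMatrix m λ₁ (n ∸ 1) (suc j)))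
             (*-congˡ (det-expansionMatrix m λ₁ (n ∸ 1) j)) ⟨
      P * det (expansionMatrix m λ₁ (n ∸ 1) (suc j)) + Q * - hₗ * e * d
        ≈⟨ +-congˡ (trans (-‿distribˡ-* _ d)
             (*-congʳ (trans (-‿distribˡ-* _ e) (*-congʳ (-‿distribʳ-* Q hₗ))))) ⟨
      P * det (expansionMatrix m λ₁ (n ∸ 1) (suc j)) - Q * hₗ * e * d ∎
      where
      P Q hₗ e d : Carrier
      P  = ∏< (suc j) (λ s → p (n ∸ s ℕ.* m))
      Q  = ∏< j (λ s → p (n ∸ s ℕ.* m))
      hₗ = h (n ∸ j ℕ.* m)
      e  = λ₁ (n ∸ suc j ℕ.* m) 0ℤ
      d  = det (expansionMatrix m λ₁ (n ∸ 1) j)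

      m≤n-sm : ∀ {s} → s ≤ j → m ≤ n ∸ s ℕ.* m
      -- From `s ≤ j < w m n` follows `suc s * m ≤ w m n * m ≤ n`, so the recursion is available in
      -- every column up to `j`.
      m≤n-sm s≤j = ℕ.m+n≤o⇒m≤o∸n m
        (ℕ.≤-trans (ℕ.*-monoˡ-≤ m (ℕ.≤-trans (s≤s s≤j) j<w)) (m/n*n≤m n m))

theorem3p7 :
  ∀ {c ℓ} (R : CommutativeRing c ℓ) →
  let open CommutativeRing R
      open Lambda R
  in
  (m : ℕ) .{{_ : NonZero m}}
  (p h : ℕ → Carrier) (λ₁ : Family) →
  IsLambdaRecursive m p (λ n _ → h n) λ₁ →
  let ∣M∣ : ℕ → ℕ → Carrier
      ∣M∣ n k = det (expansionMatrix m λ₁ n k)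
  in
  ∀ n k → 1 ℕ.≤ k → k ℕ.≤ w m n →
  ∣M∣ n k ≈
    ∏ k (λ j → p (n ∸ (j ∸ 1) ℕ.* m)) * ∣M∣ (n ∸ 1) k
    - ∏ (k ∸ 1) (λ j → p (n ∸ (j ∸ 1) ℕ.* m))
        * h (n ∸ (k ∸ 1) ℕ.* m)
        * λ₁ (n ∸ k ℕ.* m) 0ℤ
        * ∣M∣ (n ∸ 1) (k ∸ 1)
-- The hypothesis `1 ≤ k` excludes `k = 0`. Since `suc i ∸ 1` computes to `i`, the products indexed
-- from 1 agree by computation with those indexed from 0.
theorem3p7 R m p h λ₁ isRec n (suc j) _ k≤w =
  det-expansionMatrix-recursion R m p h λ₁ isRec n j k≤w
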